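{- Let $\mathcal{V}$ be a strongly irregular variety of a plural type (possibly containing constant symbols), and let $\mathcal{V}_1,\mathcal{V}_2$ be subvarieties of $R(\mathcal{V})$. Then $(\mathcal{V}_1,\mathcal{V}_2)$ is a splitting pair in $\mathbf{L}(R(\mathcal{V}))$ if and only if $(\mathcal{V}_1,\mathcal{V}_2)=(\mathcal{SL},\mathcal{V})$ or there exists $\mathcal{W}\in\mathbf{L}(\mathcal{V})$ such that $\mathcal{V}_2=R(\mathcal{W})$ and $(\mathcal{V}_1,\mathcal{W})$ is a splitting pair in $\mathbf{L}(\mathcal{V})$.
   Context: A type is plural if it contains at least one operation symbol of arity at least $2$. An identity is regular if the same variables occur on both sides. A variety $\mathcal{V}$ is strongly irregular if there is a binary term $f(x,y)$, in which both $x$ and $y$ actually occur, such that $\mathcal{V}\models f(x,y)\approx x$. The regularization $R(\mathcal{V})$ is the variety (of the same type) defined by all regular identities holding in $\mathcal{V}$. $\mathcal{SL}$ denotes $R(\mathcal{T})$, the regularization of the trivial variety $\mathcal{T}$ of the given type, i.e. the variety defined by all regular identities of that type (it is term-equivalent to the variety of semilattices, with zero if the type has constants). $\mathbf{L}(\mathcal{V})$ denotes the lattice of subvarieties of $\mathcal{V}$ ordered by inclusion. A pair $(a,b)$ of elements of a lattice $\mathbf{L}$ is a splitting pair if $a\nleq b$ and for every $c\in L$, $a\le c$ or $c\le b$. -}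

module Defs where

open import Data.Fin using (Fin; zero; suc)
open import Data.Nat using (ℕ) renaming (_≤_ to _≤ⁿ_)
open import Data.Product using (Σ; Σ-syntax; ∃; _×_; _,_; proj₁; proj₂; swap)
open import Data.Sum using (_⊎_; inj₁; inj₂)
open import Function.Bundles using (_⇔_)
open import Level using (Level; _⊔_) renaming (suc to lsuc)
open import Relation.Binary.Bundles using (Setoid)
open import Relation.Binary.Lattice.Bundles using (Lattice)
open import Relation.Binary.PropositionalEquality using (_≡_)
open import Relation.Nullary using (¬_)
open import Relation.Unary using (Pred; _∈_; _⊆′_; _≐′_)

record Signature (ℓ : Level) : Set (lsuc ℓ) where
  field
    Op    : Set ℓ
    arity : Op → ℕ

open Signature public

Plural : {ℓ : Level} → Signature ℓ → Set ℓ
Plural S = ∃ λ o → 2 ≤ⁿ arity S o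

data Term {ℓ : Level} (S : Signature ℓ) (X : Set) : Set ℓ where
  var : X → Term S X
  op  : (o : Op S) → (Fin (arity S o) → Term S X) → Term S X

infix 4 _occursIn_

_occursIn_ : {ℓ : Level} {S : Signature ℓ} {X : Set} → X → Term S X → Set
x occursIn var y   = x ≡ y
x occursIn op o ts = ∃ λ i → x occursIn ts i

infix 4 _≈_

record Identity {ℓ : Level} (S : Signature ℓ) (X : Set) : Set ℓ where
  constructor _≈_
  field
    lhs rhs : Term S X

Regular : {ℓ : Level} {S : Signature ℓ} {X : Set} → Identity S X → Set
Regular (s ≈ t) = ∀ x → x occursIn s ⇔ x occursIn t

-- Algebras have setoid carriers, so that quotients of term algebras exist.
-- As usual in universal algebra, the carrier is nonempty.
record Algebra {ℓ : Level} (S : Signature ℓ) : Set (lsuc ℓ) where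
  field
    setoid : Setoid ℓ ℓ

  open Setoid setoid public using (Carrier) renaming (_≈_ to _≈ᴬ_)

  field
    nonempty    : Carrier
    interp      : (o : Op S) → (Fin (arity S o) → Carrier) → Carrier
    interp-cong : (o : Op S) {as bs : Fin (arity S o) → Carrier} →
                  (∀ i → as i ≈ᴬ bs i) → interp o as ≈ᴬ interp o bs

  eval : {X : Set} → (X → Carrier) → Term S X → Carrier
  eval ρ (var x)   = ρ x
  eval ρ (op o ts) = interp o (λ i → eval ρ (ts i))

infix 4 _satisfies_

_satisfies_ : {ℓ : Level} {S : Signature ℓ} {X : Set} →
              Algebra S → Identity S X → Set ℓ
A satisfies (s ≈ t) = ∀ ρ → eval ρ s ≈ᴬ eval ρ t
  where open Algebra A

-- A variety is presented by a set of identities in countably many variables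
-- and is identified with its class of models: see `_≤_` and `_≋_`.  Axiom sets
-- live one universe up because `R` below quantifies over all models.
record Variety {ℓ : Level} (S : Signature ℓ) : Set (lsuc (lsuc ℓ)) where
  field
    Axioms : Pred (Identity S ℕ) (lsuc ℓ)

open Variety public

module _ {ℓ : Level} {S : Signature ℓ} where

  Mod : Variety S → Pred (Algebra S) (lsuc ℓ)
  Mod V A = ∀ e → e ∈ Axioms V → A satisfies e

  infix 4 _≤_ _≋_ _⊨_

  _≤_ : Variety S → Variety S → Set (lsuc ℓ)
  V ≤ W = Mod V ⊆′ Mod W

  _≋_ : Variety S → Variety S → Set (lsuc ℓ)
  V ≋ W = Mod V ≐′ Mod W

  _⊨_ : {X : Set} → Variety S → Identity S X → Set (lsuc ℓ)
  V ⊨ e = ∀ A → A ∈ Mod V → A satisfies e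

  -- In the term `f`, the variables `zero` and `suc zero` play the roles of
  -- x and y.
  StronglyIrregular : Variety S → Set (lsuc ℓ)
  StronglyIrregular V = Σ[ f ∈ Term S (Fin 2) ]
    zero occursIn f × suc zero occursIn f × V ⊨ (f ≈ var zero)

  R : Variety S → Variety S
  Axioms (R V) e = Regular e × V ⊨ e

  infixr 6 _∨_
  infixr 7 _∧_

  _∨_ : Variety S → Variety S → Variety S
  Axioms (V ∨ W) e = V ⊨ e × W ⊨ e

  _∧_ : Variety S → Variety S → Variety S
  Axioms (V ∧ W) e = e ∈ Axioms V ⊎ e ∈ Axioms W

  Subvariety : Variety S → Set (lsuc (lsuc ℓ))
  Subvariety V = Σ[ W ∈ Variety S ] W ≤ V

  L : Variety S → Lattice (lsuc (lsuc ℓ)) (lsuc ℓ) (lsuc ℓ)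
  L V = record
    { Carrier   = Subvariety V
    ; _≈_       = λ (U , _) (W , _) → U ≋ W
    ; _≤_       = λ (U , _) (W , _) → U ≤ W
    ; _∨_       = λ (U , U≤V) (W , W≤V) →
        U ∨ W , λ A m e a → m e ((λ B n → U≤V B n e a) , (λ B n → W≤V B n e a))
    ; _∧_       = λ (U , U≤V) (W , _) →
        U ∧ W , λ A m → U≤V A (λ e a → m e (inj₁ a))
    ; isLattice = record
      { isPartialOrder = record
        { isPreorder = record
          { isEquivalence = record
            { refl  = (λ _ m → m) , (λ _ m → m)
            ; sym   = swap
            ; trans = λ (p , q) (r , s) →
                (λ A m → r A (p A m)) , (λ A m → q A (s A m))
            }
          ; reflexive = proj₁
          ; trans     = λ p q A m → q A (p A m)
          }
        ; antisym = _,_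
        }
      ; supremum = λ _ _ →
            (λ A m e (u , _) → u A m)
          , (λ A m e (_ , w) → w A m)
          , λ _ p q A m e a → m e ((λ B n → p B n e a) , (λ B n → q B n e a))
      ; infimum = λ _ _ →
            (λ A m e a → m e (inj₁ a))
          , (λ A m e a → m e (inj₂ a))
          , λ { _ p q A m e (inj₁ a) → p A m e a
              ; _ p q A m e (inj₂ a) → q A m e a }
      }
    }

module _ {ℓ : Level} (S : Signature ℓ) where

  data TrivialAxioms : Pred (Identity S ℕ) (lsuc ℓ) where
    x≈y : TrivialAxioms (var 0 ≈ var 1)

  𝒯 : Variety S
  Axioms 𝒯 = TrivialAxioms

  𝒮ℒ : Variety S
  𝒮ℒ = R 𝒯

IsSplittingPair : {c ℓ₁ ℓ₂ : Level} (𝐋 : Lattice c ℓ₁ ℓ₂) →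
                  (a b : Lattice.Carrier 𝐋) → Set (c ⊔ ℓ₂)
IsSplittingPair 𝐋 a b = ¬ (a ≤ᴸ b) × (∀ c → a ≤ᴸ c ⊎ c ≤ᴸ b)
  where open Lattice 𝐋 using () renaming (_≤_ to _≤ᴸ_)

{-# OPTIONS --safe #-}

-- Let f be the binary term with V ⊨ f(x,y) ≈ x, so that f(p,q) ≈ p holds in
-- R V as soon as the variables of q occur in p.  Two facts reduce the theorem
-- to order theory.
--
-- (1) A subvariety U of R V lies above 𝒮ℒ or below V: if U satisfies some
--     s ≈ t with y in s but not in t, identify all other variables with x;
--     then f(x,y) ≈ f(x,s) ≈ f(x,t) ≈ x in U, and inside R V the identity
--     f(x,y) ≈ x yields s ≈ f(s,t) ≈ f(t,s) ≈ t for every axiom s ≈ t of V.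
--
-- (2) U ≤ R (U ∧ V) for every U ≤ R V: given A in U, a valuation ρ and a
--     regular identity s ≈ t, the terms in the variables of s, with p and q
--     identified when f(p,s) and f(q,s) agree at ρ, form an algebra in U ∧ V;
--     if s and t are identified there, they agree at ρ.
module Submission where

open import Defs
open import Axiom.ExcludedMiddle using (ExcludedMiddle)
open import Data.Bool using (Bool; true; false; T)
open import Data.Bool.Properties using (T?)
open import Data.Fin using (Fin)
open import Data.Fin.Patterns using (0F; 1F)
open import Data.Fin.Properties using (any?)
open import Data.Nat using (ℕ; _≟_)
open import Data.Product using (Σ-syntax; ∃; _×_; _,_; proj₁; proj₂)
open import Data.Sum using (_⊎_; inj₁; inj₂; [_,_]; map; map₂; fromInj₁; fromInj₂)
open import Data.Unit using (tt)
open import Function.Base using (_∘_; id)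
open import Function.Bundles using (_⇔_; mk⇔; module Equivalence)
open import Function.Construct.Composition using (_⇔-∘_)
open import Function.Construct.Identity using (⇔-id)
open import Function.Construct.Symmetry using (⇔-sym)
open import Level using (Level; suc; Lift; lift; lower)
open import Relation.Binary.Bundles using (Setoid)
open import Relation.Binary.PropositionalEquality using (refl)
import Relation.Binary.Reasoning.Setoid as SetoidReasoning
open import Relation.Nullary using (¬_; Dec; yes; no; contradiction)
open import Relation.Nullary.Decidable using (toWitness; fromWitness; decidable-stable; isYes)
open import Relation.Unary using (_∈_)

open Equivalence using (to; from)

private
  variable
    ℓ   : Level
    S   : Signature ℓ
    X Y : Set

-- Substitution and occurrence of variables.

bind : (X → Term S Y) → Term S X → Term S Y
bind σ (var x)   = σ x
bind σ (op o ts) = op o (λ i → bind σ (ts i))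

occursIn-bind⁺ : (σ : X → Term S Y) (t : Term S X) {x : X} {y : Y} →
                 x occursIn t → y occursIn σ x → y occursIn bind σ t
occursIn-bind⁺ σ (var _)   refl    y∈ = y∈
occursIn-bind⁺ σ (op o ts) (i , x∈) y∈ = i , occursIn-bind⁺ σ (ts i) x∈ y∈

occursIn-bind⁻ : (σ : X → Term S Y) (t : Term S X) {y : Y} →
                 y occursIn bind σ t → ∃ λ x → x occursIn t × y occursIn σ x
occursIn-bind⁻ σ (var x)   y∈ = x , refl , y∈
occursIn-bind⁻ σ (op o ts) (i , y∈) with occursIn-bind⁻ σ (ts i) y∈
... | x , x∈ , y∈σx = x , (i , x∈) , y∈σx

_occursIn?_ : (x : ℕ) (t : Term S ℕ) → Dec (x occursIn t)
x occursIn? var y   = x ≟ y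
x occursIn? op o ts = any? (λ i → x occursIn? ts i)

module _ (A : Algebra S) where
  open Algebra A
  open Setoid setoid using () renaming (refl to reflᴬ)

  eval-cong : (t : Term S X) {ρ ρ′ : X → Carrier} →
              (∀ x → x occursIn t → ρ x ≈ᴬ ρ′ x) → eval ρ t ≈ᴬ eval ρ′ t
  eval-cong (var x)   h = h x refl
  eval-cong (op o ts) h = interp-cong o λ i → eval-cong (ts i) λ x x∈ → h x (i , x∈)

  eval-bind : (σ : X → Term S Y) (ρ : Y → Carrier) (t : Term S X) →
              eval ρ (bind σ t) ≈ᴬ eval (eval ρ ∘ σ) t
  eval-bind σ ρ (var x)   = reflᴬ
  eval-bind σ ρ (op o ts) = interp-cong o λ i → eval-bind σ ρ (ts i)

satisfies-bind : (A : Algebra S) (s t : Term S X) → A satisfies (s ≈ t) →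
                 (σ : X → Term S Y) → A satisfies (bind σ s ≈ bind σ t)
satisfies-bind A s t A⊨ σ ρ = begin
  eval ρ (bind σ s)   ≈⟨ eval-bind A σ ρ s ⟩
  eval (eval ρ ∘ σ) s ≈⟨ A⊨ (eval ρ ∘ σ) ⟩
  eval (eval ρ ∘ σ) t ≈⟨ eval-bind A σ ρ t ⟨
  eval ρ (bind σ t)   ∎
  where open Algebra A
        open SetoidReasoning setoid

-- The trivial variety, `𝒮ℒ` and the two-element semilattice.

𝒯⊨ : (e : Identity S X) → 𝒯 S ⊨ e
𝒯⊨ (s ≈ t) A A∈𝒯 ρ = A∈𝒯 (var 0 ≈ var 1) x≈y λ { 0 → eval ρ s ; _ → eval ρ t }
  where open Algebra A

regular⇒𝒮ℒ≤ : (U : Variety S) → (∀ e → e ∈ Axioms U → Regular e) → 𝒮ℒ S ≤ U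
regular⇒𝒮ℒ≤ U reg A A∈𝒮ℒ e e∈U = A∈𝒮ℒ e (reg e e∈U , 𝒯⊨ e)

anyTrue? : {n : ℕ} (as : Fin n → Lift ℓ Bool) → Dec (∃ λ i → T (lower (as i)))
anyTrue? as = any? λ i → T? (lower (as i))

-- The two-element join-semilattice; constants denote its least element.
𝟚 : (S : Signature ℓ) → Algebra S
𝟚 {ℓ} S = record
  { setoid = record
    { Carrier = Lift ℓ Bool
    ; _≈_     = λ a b → Lift ℓ (T (lower a) ⇔ T (lower b))
    ; isEquivalence = record
      { refl  = lift (⇔-id _)
      ; sym   = λ p → lift (⇔-sym (lower p))
      ; trans = λ p q → lift (lower q ⇔-∘ lower p)
      }
    }
  ; nonempty    = lift false
  ; interp      = λ o as → lift (isYes (anyTrue? as))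
  ; interp-cong = λ o {as} {bs} p → lift (mk⇔
      (λ a → let i , ai = toWitness {a? = anyTrue? as} a
             in fromWitness {a? = anyTrue? bs} (i , to (lower (p i)) ai))
      (λ b → let i , bi = toWitness {a? = anyTrue? bs} b
             in fromWitness {a? = anyTrue? as} (i , from (lower (p i)) bi)))
  }

module _ {S : Signature ℓ} where
  open Algebra (𝟚 S)

  -- Every operation is the join of its arguments, so a value depends only on the variables that
  -- occur; a constant is an empty join.
  𝟚-eval : (ρ : X → Carrier) (t : Term S X) →
           T (lower (eval ρ t)) ⇔ (∃ λ x → x occursIn t × T (lower (ρ x)))
  𝟚-eval ρ (var x)   = mk⇔ (λ h → x , refl , h) λ { (_ , refl , h) → h }
  𝟚-eval ρ (op o ts) = mk⇔
    (λ h → let i , hi = toWitness {a? = anyTrue? (λ i → eval ρ (ts i))} h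
               x , x∈ , hx = to (𝟚-eval ρ (ts i)) hi
           in x , (i , x∈) , hx)
    (λ { (x , (i , x∈) , hx) →
         fromWitness {a? = anyTrue? (λ i → eval ρ (ts i))} (i , from (𝟚-eval ρ (ts i)) (x , x∈ , hx)) })

  regular⇒𝟚-satisfies : (s t : Term S X) → Regular (s ≈ t) → 𝟚 S satisfies (s ≈ t)
  regular⇒𝟚-satisfies s t r ρ = lift (mk⇔
    (λ h → let x , x∈ , hx = to (𝟚-eval ρ s) h in from (𝟚-eval ρ t) (x , to (r x) x∈ , hx))
    (λ h → let x , x∈ , hx = to (𝟚-eval ρ t) h in from (𝟚-eval ρ s) (x , from (r x) x∈ , hx)))

  𝟚∈𝒮ℒ : 𝟚 S ∈ Mod (𝒮ℒ S)
  𝟚∈𝒮ℒ (s ≈ t) (r , _) = regular⇒𝟚-satisfies s t r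

  𝟚-satisfies⇒regular : (s t : Term S ℕ) → 𝟚 S satisfies (s ≈ t) → Regular (s ≈ t)
  𝟚-satisfies⇒regular s t h x = mk⇔
    (λ x∈s → back t (to (lower (h δ)) (forth s x∈s)))
    (λ x∈t → back s (from (lower (h δ)) (forth t x∈t)))
    where
    -- Making `x` alone true turns evaluation into the test whether `x` occurs.
    δ : ℕ → Carrier
    δ y = lift (isYes (x ≟ y))

    forth : (u : Term S ℕ) → x occursIn u → T (lower (eval δ u))
    forth u x∈ = from (𝟚-eval δ u) (x , x∈ , fromWitness {a? = x ≟ x} refl)

    back : (u : Term S ℕ) → T (lower (eval δ u)) → x occursIn u
    back u hu with to (𝟚-eval δ u) hu
    ... | y , y∈ , hy with toWitness {a? = x ≟ y} hy
    ... | refl = y∈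

-- One model decides: `𝟚` lies in `𝒮ℒ` and satisfies regular identities only.
𝒮ℒ≤⇒regular : (U : Variety S) → 𝒮ℒ S ≤ U → ∀ e → e ∈ Axioms U → Regular e
𝒮ℒ≤⇒regular U p e@(s ≈ t) e∈U = 𝟚-satisfies⇒regular s t (p (𝟚 _) 𝟚∈𝒮ℒ e e∈U)

-- Regularizations and meets.

≤R : (V : Variety S) → V ≤ R V
≤R V A A∈V e (_ , V⊨e) = V⊨e A A∈V

≤-trans : (U V W : Variety S) → U ≤ V → V ≤ W → U ≤ W
≤-trans U V W U≤V V≤W A A∈U = V≤W A (U≤V A A∈U)

R-mono : (U V : Variety S) → U ≤ V → R U ≤ R V
R-mono U V U≤V A A∈RU e (r , V⊨e) = A∈RU e (r , λ B B∈U → V⊨e B (U≤V B B∈U))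

∧-greatest : (U V W : Variety S) → U ≤ V → U ≤ W → U ≤ (V ∧ W)
∧-greatest U V W p q A A∈U e (inj₁ e∈V) = p A A∈U e e∈V
∧-greatest U V W p q A A∈U e (inj₂ e∈W) = q A A∈U e e∈W

∧-lowerˡ : (U V : Variety S) → (U ∧ V) ≤ U
∧-lowerˡ U V A A∈ e e∈U = A∈ e (inj₁ e∈U)

∧-lowerʳ : (U V : Variety S) → (U ∧ V) ≤ V
∧-lowerʳ U V A A∈ e e∈V = A∈ e (inj₂ e∈V)

-- The term `f` as a binary product of terms.

module _ {S : Signature ℓ} (f : Term S (Fin 2))
         (x∈f : 0F occursIn f) (y∈f : 1F occursIn f) where

  pair : {A : Set ℓ} → A → A → Fin 2 → A
  pair a b 0F = a
  pair a b 1F = b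

  _·_ : Term S X → Term S X → Term S X
  p · q = bind (pair p q) f

  occursIn-·ˡ : (p q : Term S X) {x : X} → x occursIn p → x occursIn (p · q)
  occursIn-·ˡ p q = occursIn-bind⁺ (pair p q) f x∈f

  occursIn-·ʳ : (p q : Term S X) {x : X} → x occursIn q → x occursIn (p · q)
  occursIn-·ʳ p q = occursIn-bind⁺ (pair p q) f y∈f

  occursIn-·⁻ : (p q : Term S X) {x : X} → x occursIn (p · q) →
                x occursIn p ⊎ x occursIn q
  occursIn-·⁻ p q x∈ with occursIn-bind⁻ (pair p q) f x∈
  ... | 0F , _ , x∈p = inj₁ x∈p
  ... | 1F , _ , x∈q = inj₂ x∈q

  ·-eval-cong : (A : Algebra S) (let open Algebra A)
                {ρ : X → Carrier} {p p′ q q′ : Term S X} →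
                eval ρ p ≈ᴬ eval ρ p′ → eval ρ q ≈ᴬ eval ρ q′ →
                eval ρ (p · q) ≈ᴬ eval ρ (p′ · q′)
  ·-eval-cong A {ρ} {p} {p′} {q} {q′} hp hq = begin
    eval ρ (p · q)               ≈⟨ eval-bind A _ ρ f ⟩
    eval (eval ρ ∘ pair p q) f   ≈⟨ eval-cong A f (λ { 0F _ → hp ; 1F _ → hq }) ⟩
    eval (eval ρ ∘ pair p′ q′) f ≈⟨ eval-bind A _ ρ f ⟨
    eval ρ (p′ · q′)             ∎
    where open Algebra A
          open SetoidReasoning setoid

  -- This single identity singles out `V` among the models of `R V`; see `R∧Absorbs⇒∈`.
  Absorbs : Algebra S → Set ℓ
  Absorbs A = A satisfies (f ≈ var 0F)

  ·-absorb : (A : Algebra S) → Absorbs A → (p q : Term S X) → A satisfies (p · q ≈ p)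
  ·-absorb A h p q = satisfies-bind A f (var 0F) h (pair p q)

  -- Both variables occur in `f`, so each side has the variables of `s` and of `t`, even if `s ≈ t`
  -- is irregular. This gives a regular stand-in for `s ≈ t`, which `·-comm⇒≈` undoes under
  -- absorption.
  ·-regular-comm : (s t : Term S X) → Regular (s · t ≈ t · s)
  ·-regular-comm s t x = mk⇔
    (λ x∈ → [ occursIn-·ʳ t s , occursIn-·ˡ t s ] (occursIn-·⁻ s t x∈))
    (λ x∈ → [ occursIn-·ʳ s t , occursIn-·ˡ s t ] (occursIn-·⁻ t s x∈))

  ·-comm⇒≈ : (A : Algebra S) → Absorbs A → (s t : Term S X) →
             A satisfies (s · t ≈ t · s) → A satisfies (s ≈ t)
  ·-comm⇒≈ A h s t comm ρ = begin
    eval ρ s       ≈⟨ ·-absorb A h s t ρ ⟨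
    eval ρ (s · t) ≈⟨ comm ρ ⟩
    eval ρ (t · s) ≈⟨ ·-absorb A h t s ρ ⟩
    eval ρ t       ∎
    where open Algebra A
          open SetoidReasoning setoid

  -- The position of `V` and `𝒮ℒ` inside `R V`.

  module _ (V : Variety S) (V-absorbs : V ⊨ (f ≈ var 0F)) where

    -- Since `q` brings no new variable, the identity is regular; `V` satisfies it by absorption, so
    -- it is an axiom of `R V`.
    R-absorb : (A : Algebra S) → A ∈ Mod (R V) → (p q : Term S ℕ) →
               (∀ x → x occursIn q → x occursIn p) → A satisfies (p · q ≈ p)
    R-absorb A A∈RV p q q⊆p = A∈RV (p · q ≈ p)
      ( (λ x → mk⇔ (λ x∈ → [ id , q⊆p x ] (occursIn-·⁻ p q x∈)) (occursIn-·ˡ p q))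
      , λ B B∈V → ·-absorb B (V-absorbs B B∈V) p q)

    R∧Absorbs⇒∈ : (A : Algebra S) → A ∈ Mod (R V) → Absorbs A → A ∈ Mod V
    R∧Absorbs⇒∈ A A∈RV h e@(s ≈ t) e∈V =
      ·-comm⇒≈ A h s t (A∈RV (s · t ≈ t · s) (·-regular-comm s t , V⊨))
      where
      V⊨ : V ⊨ (s · t ≈ t · s)
      V⊨ B B∈V η = begin
        eval η (s · t) ≈⟨ ·-absorb B (V-absorbs B B∈V) s t η ⟩
        eval η s       ≈⟨ B∈V e e∈V η ⟩
        eval η t       ≈⟨ ·-absorb B (V-absorbs B B∈V) t s η ⟨
        eval η (t · s) ∎
        where open Algebra B
              open SetoidReasoning setoid

    -- With `x` false and `y` true, `f` is true in `𝟚`, so this member of `𝒮ℒ` violates absorption.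
    𝒮ℒ≰ : ¬ (𝒮ℒ S ≤ V)
    𝒮ℒ≰ p with to (𝟚-eval {S = S} δ (var 0F))
                  (to (lower (absorbs δ)) (from (𝟚-eval δ f) (1F , y∈f , tt)))
      where
      δ : Fin 2 → Lift ℓ Bool
      δ 0F = lift false
      δ 1F = lift true

      absorbs : 𝟚 S satisfies (f ≈ var 0F)
      absorbs = V-absorbs (𝟚 S) (p (𝟚 S) 𝟚∈𝒮ℒ)
    ... | _ , refl , ()

    -- A model of both is trivial: `𝒮ℒ` gives `s · t ≈ t · s` for all terms, and absorption reduces
    -- this to `s ≈ t`.
    ≤𝒮ℒ∧≤V⇒≤ : (U W : Variety S) → U ≤ 𝒮ℒ S → U ≤ V → U ≤ W
    ≤𝒮ℒ∧≤V⇒≤ U W U≤𝒮ℒ U≤V A A∈U (s ≈ t) _ =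
      ·-comm⇒≈ A (V-absorbs A (U≤V A A∈U)) s t
        (U≤𝒮ℒ A A∈U (s · t ≈ t · s) (·-regular-comm s t , 𝒯⊨ (s · t ≈ t · s)))

    irregular⇒Absorbs : (A : Algebra S) → A ∈ Mod (R V) → (s t : Term S ℕ) →
                        A satisfies (s ≈ t) → (y : ℕ) → y occursIn s → ¬ (y occursIn t) →
                        Absorbs A
    irregular⇒Absorbs A A∈RV s t A⊨ y y∈s y∉t ρ = begin
      eval ρ f                     ≈⟨ eval-cong A f (λ { 0F _ → reflᴬ ; 1F _ → reflᴬ }) ⟩
      eval (eval η ∘ pair x₀ x₁) f ≈⟨ eval-bind A _ η f ⟨
      -- `x₁` occurs in `s′` because `y` occurs in `s`; `V` reduces both sides to `x₀`.
      eval η (x₀ · x₁)             ≈⟨ A∈RV (x₀ · x₁ ≈ x₀ · s′) (regular , V⊨) η ⟩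
      eval η (x₀ · s′)             ≈⟨ ·-eval-cong A {p = x₀} {x₀} {s′} {t′} reflᴬ
                                         (satisfies-bind A s t A⊨ σ η) ⟩
      -- `y` does not occur in `t`, so `t′` has no variable but that of `x₀`.
      eval η (x₀ · t′)             ≈⟨ R-absorb A A∈RV x₀ t′ t′⊆x₀ η ⟩
      ρ 0F                         ∎
      where
      open Algebra A
      open Setoid setoid using () renaming (refl to reflᴬ)
      open SetoidReasoning setoid

      -- Axioms of `R V` have variables in `ℕ`. Only 0 and 1 occur in the terms evaluated at `η`, so
      -- beyond 1 the last clause is a default.
      η : ℕ → Carrier
      η 0 = ρ 0F
      η _ = ρ 1F

      x₀ x₁ : Term S ℕ
      x₀ = var 0
      x₁ = var 1

      σ : ℕ → Term S ℕ
      σ z with y ≟ z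
      ... | yes _ = x₁
      ... | no  _ = x₀

      s′ t′ : Term S ℕ
      s′ = bind σ s
      t′ = bind σ t

      1∈σy : 1 occursIn σ y
      1∈σy with y ≟ y
      ... | yes _  = refl
      ... | no y≢y = contradiction refl y≢y

      σ⊆ : (z : ℕ) {x : ℕ} → x occursIn σ z → x occursIn (x₀ · x₁)
      σ⊆ z x∈ with y ≟ z
      ... | yes _ = occursIn-·ʳ x₀ x₁ x∈
      ... | no  _ = occursIn-·ˡ x₀ x₁ x∈

      regular : Regular (x₀ · x₁ ≈ x₀ · s′)
      regular x = mk⇔
        (λ x∈ → [ occursIn-·ˡ x₀ s′
                , (λ { refl → occursIn-·ʳ x₀ s′ (occursIn-bind⁺ σ s y∈s 1∈σy) })
                ] (occursIn-·⁻ x₀ x₁ x∈))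
        (λ x∈ → [ occursIn-·ˡ x₀ x₁
                , (λ x∈s′ → let z , _ , x∈σz = occursIn-bind⁻ σ s x∈s′ in σ⊆ z x∈σz)
                ] (occursIn-·⁻ x₀ s′ x∈))

      V⊨ : V ⊨ (x₀ · x₁ ≈ x₀ · s′)
      V⊨ B B∈V θ = B.trans (·-absorb B h x₀ x₁ θ) (B.sym (·-absorb B h x₀ s′ θ))
        where module B = Setoid (Algebra.setoid B)
              h = V-absorbs B B∈V

      t′⊆x₀ : ∀ x → x occursIn t′ → x occursIn x₀
      t′⊆x₀ x x∈ with occursIn-bind⁻ σ t x∈
      ... | z , z∈t , x∈σz with y ≟ z
      ...   | yes refl = contradiction z∈t y∉t
      ...   | no  _    = x∈σz

    𝒮ℒ≤⊎≤V : ExcludedMiddle (suc ℓ) → (U : Variety S) → U ≤ R V → 𝒮ℒ S ≤ U ⊎ U ≤ V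
    -- The search covers all identities of `U`, not just axioms, so an extra variable on the right
    -- is found by swapping the sides.
    𝒮ℒ≤⊎≤V em U U≤RV with em {Σ[ s ∈ Term S ℕ ] Σ[ t ∈ Term S ℕ ] Σ[ y ∈ ℕ ]
                              (U ⊨ (s ≈ t) × y occursIn s × ¬ (y occursIn t))}
    ... | yes (s , t , y , U⊨ , y∈s , y∉t) = inj₂ λ A A∈U →
      R∧Absorbs⇒∈ A (U≤RV A A∈U) (irregular⇒Absorbs A (U≤RV A A∈U) s t (U⊨ A A∈U) y y∈s y∉t)
    ... | no none = inj₁ (regular⇒𝒮ℒ≤ U λ { (s ≈ t) e∈U x → mk⇔
        (λ x∈s → decidable-stable (x occursIn? t) λ x∉t →
          none (s , t , x , (λ A A∈U → A∈U (s ≈ t) e∈U) , x∈s , x∉t))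
        (λ x∈t → decidable-stable (x occursIn? s) λ x∉s →
          none (t , s , x , (λ A A∈U ρ → Setoid.sym (Algebra.setoid A) (A∈U (s ≈ t) e∈U ρ))
               , x∈t , x∉s)) })

    -- Localising a model of `R V` at a term and a valuation.

    module _ (A : Algebra S) (A∈RV : A ∈ Mod (R V)) (s : Term S ℕ)
             (ρ : ℕ → Algebra.Carrier A) where
      open Algebra A
      open Setoid setoid using (sym) renaming (refl to reflᴬ; trans to transᴬ)
      open SetoidReasoning setoid

      Below : Term S ℕ → Set
      Below p = ∀ x → x occursIn p → x occursIn s

      ·-Below : {p q : Term S ℕ} → Below p → Below q → Below (p · q)
      ·-Below {p} {q} p≤s q≤s x x∈ = [ p≤s x , q≤s x ] (occursIn-·⁻ p q x∈)

      -- The factor `s` gives both sides exactly the variables of `s`, so an identity of `V` that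
      -- may be irregular becomes an axiom of `R V`.
      Below-cong : {p q : Term S ℕ} → Below p → Below q → V ⊨ (p ≈ q) →
                   eval ρ (p · s) ≈ᴬ eval ρ (q · s)
      Below-cong {p} {q} p≤s q≤s V⊨p≈q = A∈RV (p · s ≈ q · s)
        ( (λ x → mk⇔
            (λ x∈ → occursIn-·ʳ q s ([ p≤s x , id ] (occursIn-·⁻ p s x∈)))
            (λ x∈ → occursIn-·ʳ p s ([ q≤s x , id ] (occursIn-·⁻ q s x∈))))
        , λ B B∈V η → ·-eval-cong B {p = p} {q} {s} {s} (V⊨p≈q B B∈V η)
                        (Setoid.refl (Algebra.setoid B))) ρ

      Below-op : (o : Op S) (ps : Fin (arity S o) → ∃ Below) → Below (op o (proj₁ ∘ ps))
      Below-op o ps x (i , x∈) = proj₂ (ps i) x x∈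

      -- The factors s inside make op o a function of the classes of its
      -- arguments; the one outside is needed when o is a constant.
      op-· : (o : Op S) (ps : Fin (arity S o) → ∃ Below) →
             eval ρ (op o (proj₁ ∘ ps) · s) ≈ᴬ
             eval ρ (op o (λ i → proj₁ (ps i) · s) · s)
      op-· o ps = Below-cong (Below-op o ps)
        (Below-op o λ i → proj₁ (ps i) · s , ·-Below (proj₂ (ps i)) λ _ → id)
        λ B B∈V η → Algebra.interp-cong B o λ i →
          Setoid.sym (Algebra.setoid B) (·-absorb B (V-absorbs B B∈V) (proj₁ (ps i)) s η)

      localisation : Algebra S
      localisation = record
        { setoid = record
          { Carrier       = Lift ℓ (∃ Below)
          ; _≈_           = λ (lift (p , _)) (lift (q , _)) → eval ρ (p · s) ≈ᴬ eval ρ (q · s)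
          ; isEquivalence = record { refl = reflᴬ ; sym = sym ; trans = transᴬ }
          }
        -- `s` may contain no variable, but it is always below itself.
        ; nonempty    = lift (s , λ _ → id)
        ; interp      = λ o ps → lift (op o (proj₁ ∘ lower ∘ ps) , Below-op o (lower ∘ ps))
        ; interp-cong = λ o {ps} {qs} ps≈qs → begin
            eval ρ (op o (proj₁ ∘ lower ∘ ps) · s)
              ≈⟨ op-· o (lower ∘ ps) ⟩
            eval ρ (op o (λ i → proj₁ (lower (ps i)) · s) · s)
              ≈⟨ ·-eval-cong A {p = op o _} {op o _} {s} {s} (interp-cong o ps≈qs) reflᴬ ⟩
            eval ρ (op o (λ i → proj₁ (lower (qs i)) · s) · s)
              ≈⟨ op-· o (lower ∘ qs) ⟨
            eval ρ (op o (proj₁ ∘ lower ∘ qs) · s) ∎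
        }

      private module B = Algebra localisation

      term : B.Carrier → Term S ℕ
      term = proj₁ ∘ lower

      -- Operations of `localisation` build terms, so evaluation there is substitution. The algebra
      -- `C` is general because the lemma serves `A` as well as models of `V`.
      term-eval : (C : Algebra S) (let module C = Algebra C) (θ : ℕ → C.Carrier)
                  (η : X → B.Carrier) (t : Term S X) →
                  C.eval θ (term (B.eval η t)) C.≈ᴬ C.eval (C.eval θ ∘ term ∘ η) t
      term-eval C θ η (var x)   = Setoid.refl (Algebra.setoid C)
      term-eval C θ η (op o ts) = Algebra.interp-cong C o λ i → term-eval C θ η (ts i)

      localisation-satisfies : (l r : Term S X) → A satisfies (l ≈ r) →
                               localisation satisfies (l ≈ r)
      localisation-satisfies l r A⊨ η =
        ·-eval-cong A {p = term (B.eval η l)} {term (B.eval η r)} {s} {s} (begin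
          eval ρ (term (B.eval η l))   ≈⟨ term-eval A ρ η l ⟩
          eval (eval ρ ∘ term ∘ η) l   ≈⟨ A⊨ _ ⟩
          eval (eval ρ ∘ term ∘ η) r   ≈⟨ term-eval A ρ η r ⟨
          eval ρ (term (B.eval η r))   ∎) reflᴬ

      -- `A` itself need not absorb. Instead, `V` equates the two terms, and `Below-cong` carries
      -- this to `A` after multiplication by `s`.
      localisation-absorbs : Absorbs localisation
      localisation-absorbs η =
        Below-cong (proj₂ (lower (B.eval η f))) (proj₂ (lower (η 0F))) λ C C∈V θ →
          Setoid.trans (Algebra.setoid C) (term-eval C θ η f) (V-absorbs C C∈V _)

      localisation∈ : (U : Variety S) → U ≤ R V → A ∈ Mod U → localisation ∈ Mod (U ∧ V)
      localisation∈ U U≤RV A∈U = ∈∧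
        where
        ∈U : localisation ∈ Mod U
        ∈U (l ≈ r) e∈U = localisation-satisfies l r (A∈U (l ≈ r) e∈U)

        ∈∧ : localisation ∈ Mod (U ∧ V)
        ∈∧ e (inj₁ e∈U) = ∈U e e∈U
        ∈∧ e (inj₂ e∈V) = R∧Absorbs⇒∈ localisation
          (U≤RV localisation ∈U) localisation-absorbs e e∈V

    ≤R∧ : (U : Variety S) → U ≤ R V → U ≤ R (U ∧ V)
    ≤R∧ U U≤RV A A∈U (s ≈ t) (r , U∧V⊨) ρ = begin
      eval ρ s                   ≈⟨ R-absorb A A∈RV s s (λ _ → id) ρ ⟨
      eval ρ (s · s)             ≈⟨ agree s (λ _ → id) ⟨
      -- Equality in `B` unfolds to equality in `A` of these two products.
      eval ρ (term′ s · s)       ≈⟨ U∧V⊨ B (localisation∈ A A∈RV s ρ U U≤RV A∈U) η ⟩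
      eval ρ (term′ t · s)       ≈⟨ agree t (λ x → from (r x)) ⟩
      eval ρ (t · s)             ≈⟨ R-absorb A A∈RV t s (λ x → to (r x)) ρ ⟩
      eval ρ t                   ∎
      where
      open Algebra A
      open Setoid setoid using () renaming (refl to reflᴬ; trans to transᴬ)
      open SetoidReasoning setoid

      A∈RV : A ∈ Mod (R V)
      A∈RV = U≤RV A A∈U

      B : Algebra S
      B = localisation A A∈RV s ρ

      -- Variables of `s` stand for themselves; the default `s` is never met in `t`, whose variables
      -- lie in `s` by regularity.
      η : ℕ → Algebra.Carrier B
      η x with x occursIn? s
      ... | yes x∈s = lift (var x , λ { _ refl → x∈s })
      ... | no  _   = lift (s , λ _ → id)

      term′ : Term S ℕ → Term S ℕ
      term′ u = term A A∈RV s ρ (Algebra.eval B η u)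

      agree-var : ∀ x → x occursIn s → eval ρ (term A A∈RV s ρ (η x)) ≈ᴬ ρ x
      agree-var x x∈s with x occursIn? s
      ... | yes _  = reflᴬ
      ... | no x∉s = contradiction x∈s x∉s

      agree : (u : Term S ℕ) → (∀ x → x occursIn u → x occursIn s) →
              eval ρ (term′ u · s) ≈ᴬ eval ρ (u · s)
      agree u u≤s = ·-eval-cong A {p = term′ u} {u} {s} {s}
        (transᴬ (term-eval A A∈RV s ρ A ρ η u)
                (eval-cong A u λ x x∈u → agree-var x (u≤s x x∈u))) reflᴬ

-- Axioms of `U` are regular and hold in `U ∧ V`, hence are axioms of `R (U ∧ V)`. For `U ≤ R V`,
-- together with `≤R∧`, this recovers `U` from its part in `V`.
𝒮ℒ≤⇒R∧≤ : (U V : Variety S) → 𝒮ℒ S ≤ U → R (U ∧ V) ≤ U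
𝒮ℒ≤⇒R∧≤ U V 𝒮ℒ≤U A A∈R e e∈U =
  A∈R e (𝒮ℒ≤⇒regular U 𝒮ℒ≤U e e∈U , λ B B∈ → B∈ e (inj₁ e∈U))

-- Splitting pairs.

theorem8 : {ℓ : Level} → ExcludedMiddle (suc ℓ) →
    (S : Signature ℓ) → Plural S →
    (V : Variety S) → StronglyIrregular V →
    (V₁ V₂ : Variety S) (V₁≤RV : V₁ ≤ R V) (V₂≤RV : V₂ ≤ R V) →
    IsSplittingPair (L (R V)) (V₁ , V₁≤RV) (V₂ , V₂≤RV)
      ⇔
    ((V₁ ≋ 𝒮ℒ S × V₂ ≋ V)
      ⊎ (Σ[ W ∈ Variety S ] Σ[ W≤V ∈ W ≤ V ]
          (V₂ ≋ R W ×
           (Σ[ V₁≤V ∈ V₁ ≤ V ] IsSplittingPair (L V) (V₁ , V₁≤V) (W , W≤V)))))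
theorem8 {ℓ} em S _ V (f , x∈f , y∈f , V⊨f≈x) V₁ V₂ V₁≤RV V₂≤RV = mk⇔ split⇒ ⇒split
  where
  dichotomy : (U : Variety S) → U ≤ R V → 𝒮ℒ S ≤ U ⊎ U ≤ V
  dichotomy = 𝒮ℒ≤⊎≤V f x∈f y∈f V V⊨f≈x em

  below-R∧ : (U : Variety S) → U ≤ R V → U ≤ R (U ∧ V)
  below-R∧ = ≤R∧ f x∈f y∈f V V⊨f≈x

  𝒮ℒ≰V : ¬ (𝒮ℒ S ≤ V)
  𝒮ℒ≰V = 𝒮ℒ≰ f x∈f y∈f V V⊨f≈x

  𝒮ℒ≤RV : 𝒮ℒ S ≤ R V
  𝒮ℒ≤RV = regular⇒𝒮ℒ≤ (R V) λ _ → proj₁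

  -- `f` absorbs in `W` as well, so `R∧Absorbs⇒∈` applies with `W` in place of `V`.
  R∧V≤ : (W : Variety S) → W ≤ V → (R W ∧ V) ≤ W
  R∧V≤ W W≤V A A∈ = R∧Absorbs⇒∈ f x∈f y∈f W (λ B B∈W → V⊨f≈x B (W≤V B B∈W)) A
    (∧-lowerˡ (R W) V A A∈) (V⊨f≈x A (∧-lowerʳ (R W) V A A∈))

  Splits-V : Set (suc (suc ℓ))
  Splits-V = Σ[ W ∈ Variety S ] Σ[ W≤V ∈ W ≤ V ] (V₂ ≋ R W ×
    (Σ[ V₁≤V ∈ V₁ ≤ V ] IsSplittingPair (L V) (V₁ , V₁≤V) (W , W≤V)))

  split⇒ : IsSplittingPair (L (R V)) (V₁ , V₁≤RV) (V₂ , V₂≤RV) →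
           (V₁ ≋ 𝒮ℒ S × V₂ ≋ V) ⊎ Splits-V
  split⇒ (V₁≰V₂ , split) with dichotomy V₂ V₂≤RV
  ... | inj₂ V₂≤V = inj₁ ((V₁≤𝒮ℒ , 𝒮ℒ≤V₁) , (V₂≤V , V≤V₂))
    where
    V₁≤𝒮ℒ : V₁ ≤ 𝒮ℒ S
    -- The splitting is tested at `𝒮ℒ`, which cannot lie below `V₂` as `V₂ ≤ V`.
    V₁≤𝒮ℒ with split (𝒮ℒ S , 𝒮ℒ≤RV)
    ... | inj₁ p = p
    ... | inj₂ p = contradiction (≤-trans (𝒮ℒ S) V₂ V p V₂≤V) 𝒮ℒ≰V

    V₁≰V : ¬ (V₁ ≤ V)
    -- Otherwise `V₁`, below both `𝒮ℒ` and `V`, has only trivial models and lies below `V₂`.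
    V₁≰V p = V₁≰V₂ (≤𝒮ℒ∧≤V⇒≤ f x∈f y∈f V V⊨f≈x V₁ V₂ V₁≤𝒮ℒ p)

    𝒮ℒ≤V₁ : 𝒮ℒ S ≤ V₁
    𝒮ℒ≤V₁ = fromInj₁ (λ p → contradiction p V₁≰V) (dichotomy V₁ V₁≤RV)

    V≤V₂ : V ≤ V₂
    V≤V₂ = fromInj₂ (λ p → contradiction p V₁≰V) (split (V , ≤R V))
  -- `V₂` is recovered as `R W` from its part `W` in `V`; a subvariety of `V` is below `W` as soon
  -- as it is below `V₂`.
  ... | inj₁ 𝒮ℒ≤V₂ = inj₂
      ( W , ∧-lowerʳ V₂ V
      , (below-R∧ V₂ V₂≤RV , RW≤V₂)
      , V₁≤V
      , (λ p → V₁≰V₂ (≤-trans V₁ W V₂ p (∧-lowerˡ V₂ V)))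
      , λ (U , U≤V) → map₂ (λ U≤V₂ → ∧-greatest U V₂ V U≤V₂ U≤V)
                        (split (U , ≤-trans U V (R V) U≤V (≤R V))))
    where
    W : Variety S
    W = V₂ ∧ V

    RW≤V₂ : R W ≤ V₂
    RW≤V₂ = 𝒮ℒ≤⇒R∧≤ V₂ V 𝒮ℒ≤V₂

    V₁≤V : V₁ ≤ V
    V₁≤V with split (V , ≤R V)
    ... | inj₁ p = p
    -- `V ≤ V₂` gives `V ≤ W`, so `R V ≤ R W ≤ V₂` and `V₁` would lie below `V₂`.
    ... | inj₂ V≤V₂ = contradiction
      (≤-trans V₁ (R V) V₂ V₁≤RV
        (≤-trans (R V) (R W) V₂
          (R-mono V W (∧-greatest V V₂ V V≤V₂ λ _ → id)) RW≤V₂))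
      V₁≰V₂

  ⇒split : (V₁ ≋ 𝒮ℒ S × V₂ ≋ V) ⊎ Splits-V →
           IsSplittingPair (L (R V)) (V₁ , V₁≤RV) (V₂ , V₂≤RV)
  ⇒split (inj₁ ((V₁≤𝒮ℒ , 𝒮ℒ≤V₁) , (V₂≤V , V≤V₂))) =
      (λ p → 𝒮ℒ≰V (≤-trans (𝒮ℒ S) V₁ V 𝒮ℒ≤V₁ (≤-trans V₁ V₂ V p V₂≤V)))
    , λ (U , U≤RV) → map (≤-trans V₁ (𝒮ℒ S) U V₁≤𝒮ℒ) (λ p → ≤-trans U V V₂ p V≤V₂)
                       (dichotomy U U≤RV)
  ⇒split (inj₂ (W , W≤V , (V₂≤RW , RW≤V₂) , V₁≤V , V₁≰W , split)) =
      (λ p → V₁≰W (≤-trans V₁ (R W ∧ V) W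
        (∧-greatest V₁ (R W) V (≤-trans V₁ V₂ (R W) p V₂≤RW) V₁≤V) (R∧V≤ W W≤V)))
    -- An arbitrary `U` is tested through `U ∧ V`: if that is below `W`, then
    -- `U ≤ R (U ∧ V) ≤ R W ≤ V₂`.
    , λ (U , U≤RV) → map
        (λ p → ≤-trans V₁ (U ∧ V) U p (∧-lowerˡ U V))
        (λ p → ≤-trans U (R (U ∧ V)) V₂ (below-R∧ U U≤RV)
                 (≤-trans (R (U ∧ V)) (R W) V₂ (R-mono (U ∧ V) W p) RW≤V₂))
        (split ((U ∧ V) , ∧-lowerʳ U V))
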